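{- Let $F$ be the simplicial complex on vertex set $\{v_1,v_2,v_3,v_4\}$ whose edge set is the downward closure of $\{v_1v_2v_3,\ v_2v_3v_4,\ v_1v_4\}$. For every $\varepsilon>0$ there is $n_0\in\mathbb N$ such that for every $n\ge n_0$, $$\Big(\frac29-\varepsilon\Big)\binom n3\le \mathrm{ex}(n,F)\le \Big(\frac29+\varepsilon\Big)\binom n3.$$
   Context: A simplicial complex is a pair $H=(V,E)$ with $E\subseteq\mathscr P(V)$ closed under taking subsets; all sets in $E$ (including the empty set and singletons) count as edges. $H$ contains a copy of $F$ if there is an injection $\varphi:V(F)\to V(H)$ with $\varphi(e)\in E(H)$ for every $e\in E(F)$. $\mathrm{ex}(n,F)$ is the maximum number of edges of a simplicial complex on $n$ vertices containing no copy of $F$. -}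

module Defs where

open import Data.Nat using (ℕ; zero; suc)
open import Data.Bool using (Bool; true; false; _∧_; _∨_)
open import Data.Fin using (Fin; zero; suc; _≟_)
open import Data.Fin.Subset using (Subset; _⊆_; inside; outside)
open import Data.Vec using (Vec; []; _∷_; tabulate; lookup)
open import Data.List using (List; []; _∷_; _++_; map; length; filterᵇ; allFin)
open import Data.Bool.ListAction using (any)
open import Data.Sum using (_⊎_)
open import Data.Product using (Σ; _×_)
open import Function.Definitions using (Injective)
open import Relation.Binary.PropositionalEquality using (_≡_)
open import Relation.Nullary.Decidable using (⌊_⌋)

Family : ℕ → Set
Family n = Subset n → Bool

IsEdge : {n : ℕ} → Family n → Subset n → Set
IsEdge E A = E A ≡ true

IsSimplicialComplex : {n : ℕ} → Family n → Set
IsSimplicialComplex {n} E = (A B : Subset n) → B ⊆ A → IsEdge E A → IsEdge E B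

allSubsets : (n : ℕ) → List (Subset n)
allSubsets zero = [] ∷ []
allSubsets (suc n) = map (inside ∷_) (allSubsets n) ++ map (outside ∷_) (allSubsets n)

numEdges : {n : ℕ} → Family n → ℕ
numEdges {n} E = length (filterᵇ E (allSubsets n))

image : {m n : ℕ} → (Fin m → Fin n) → Subset m → Subset n
image {m} φ e = tabulate (λ j → any (λ i → lookup e i ∧ ⌊ φ i ≟ j ⌋) (allFin m))

ContainsCopy : {m n : ℕ} → (Subset m → Set) → Family n → Set
ContainsCopy {m} {n} FE E =
  Σ (Fin m → Fin n) λ φ → Injective _≡_ _≡_ φ × ((e : Subset m) → FE e → IsEdge E (image φ e))

f123 : Subset 4
f123 = inside ∷ inside ∷ inside ∷ outside ∷ []

f234 : Subset 4
f234 = outside ∷ inside ∷ inside ∷ inside ∷ []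

f14 : Subset 4
f14 = inside ∷ outside ∷ outside ∷ inside ∷ []

FEdge : Subset 4 → Set
FEdge e = e ⊆ f123 ⊎ (e ⊆ f234 ⊎ e ⊆ f14)

{-# OPTIONS --safe #-}

-- Lower bound: in the complete tripartite complex any two vertices spanning an edge have different
-- colours, whereas the vertices of F pairwise span edges and would need four colours.
--
-- Upper bound: an edge with four vertices contains F, so up to O(n²) only the triples matter.  Let
-- N(xy) be the set of all z with xyz an edge.  Since F is excluded, N(xy) spans no pair, and for
-- every edge xyz the sets N(xy), N(yz), N(zx) are disjoint.  Let M be the largest value of
-- d(xy) + d(yz) + d(zx) over all edges xyz, where d = |N|.  Summing over the edges gives
-- 3 Σ d² ≤ M Σ d (sums over ordered pairs), so by Cauchy–Schwarz 3 Σ d ≤ M Q with Q the number of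
-- ordered pairs that are edges.  The three sets N of a heaviest edge give Q ≤ n² − M²/3.  Hence
-- 9 Σ d ≤ M (3n² − M²) ≤ 2n³, and Σ d is six times the number of triples.
module Submission where

open import Defs

module Counting where

  open import Data.Nat using (ℕ; zero; suc; z≤n; s≤s; _+_; _*_; _∸_; _≤_)
  open import Data.Nat.Combinatorics using (_C_; nC1≡n; nCk+nC[k+1]≡[n+1]C[k+1])
  open import Data.Nat.Properties hiding (_≟_)
  open import Data.Nat.Tactic.RingSolver using (solve-∀)
  open import Algebra.Properties.Semiring.Sum +-*-semiring using (sum; sum-cong-≗; ∑-distrib-+; ∑-comm; *-distribˡ-sum; *-distribʳ-sum)
  open import Data.Bool using (Bool; true; false; _∧_; not; T?)
  open import Data.Bool.Properties using (T-≡; T-∧)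
  open import Data.Empty using (⊥; ⊥-elim)
  open import Data.Fin using (Fin; zero; suc; toℕ; _≟_)
  open import Data.Fin.Patterns using (0F; 1F; 2F; 3F)
  import Data.Fin.Properties as Fin
  open import Data.Fin.Subset using (Subset; _⊆_; _∈_; _∪_; ⁅_⁆; ∣_∣; inside; outside) renaming (⊥ to ∅)
  open import Data.Fin.Subset.Properties using (∪-identityˡ; ∪-identityʳ; ∪-assoc; ∪-comm; x∈⁅x⁆; x∈p∪q⁺; p⊆p∪q; drop-∷-⊆; _⊆?_)
  open import Data.List using ([]; _∷_; _++_; map; length; filterᵇ; allFin)
  open import Data.List.Membership.Propositional using (lose)
  open import Data.List.Membership.Propositional.Properties using (∈-allFin)
  open import Data.List.Properties using (filter-++; length-++)
  open import Data.List.Relation.Unary.Any using (satisfied)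
  open import Data.List.Relation.Unary.Any.Properties using (any⁺; any⁻)
  open import Data.Product using (Σ; _×_; _,_; proj₁; proj₂)
  open import Data.Sum using (inj₁; inj₂)
  open import Data.Vec using ([]; _∷_; here; there; lookup)
  open import Data.Vec.Properties using ([]=⇒lookup; lookup⇒[]=; lookup∘tabulate)
  open import Function using (_∘_; Equivalence)
  open import Function.Definitions using (Injective)
  open import Relation.Nullary using (¬_; yes; no; does)
  open import Relation.Nullary.Decidable using (dec-false; from-yes; fromWitness; toWitness; _⊎-dec_)
  open import Relation.Unary using (Decidable)
  open import Relation.Binary.PropositionalEquality

  -- Finite sums and elementary inequalities over ℕ

  sum-mono : ∀ {n} {f g : Fin n → ℕ} → (∀ i → f i ≤ g i) → sum f ≤ sum g
  sum-mono {zero}  f≤g = z≤n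
  sum-mono {suc n} f≤g = +-mono-≤ (f≤g zero) (sum-mono (f≤g ∘ suc))

  sum-const : ∀ n c → sum {n} (λ _ → c) ≡ n * c
  sum-const zero    c = refl
  sum-const (suc n) c = cong (c +_) (sum-const n c)

  sum-1 : ∀ n → sum {n} (λ _ → 1) ≡ n
  sum-1 n = trans (sum-const n 1) (*-identityʳ n)

  sum²-1 : ∀ n → sum {n} (λ _ → sum {n} (λ _ → 1)) ≡ n * n
  sum²-1 n = trans (sum-const n _) (cong (n *_) (sum-1 n))

  sum²-cong : ∀ {m n} {f g : Fin m → Fin n → ℕ} → (∀ i j → f i j ≡ g i j) →
    sum (λ i → sum (f i)) ≡ sum (λ i → sum (g i))
  sum²-cong f≡g = sum-cong-≗ (sum-cong-≗ ∘ f≡g)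

  sum²-mono : ∀ {m n} {f g : Fin m → Fin n → ℕ} → (∀ i j → f i j ≤ g i j) →
    sum (λ i → sum (f i)) ≤ sum (λ i → sum (g i))
  sum²-mono f≤g = sum-mono (sum-mono ∘ f≤g)

  sum²-distrib-+ : ∀ {m n} (f g : Fin m → Fin n → ℕ) →
    sum (λ i → sum (λ j → f i j + g i j)) ≡ sum (λ i → sum (f i)) + sum (λ i → sum (g i))
  sum²-distrib-+ f g =
    trans (sum-cong-≗ (λ i → ∑-distrib-+ (f i) (g i))) (∑-distrib-+ (sum ∘ f) (sum ∘ g))

  sum²-distribˡ-* : ∀ {m n} c (f : Fin m → Fin n → ℕ) →
    sum (λ i → sum (λ j → c * f i j)) ≡ c * sum (λ i → sum (f i))
  sum²-distribˡ-* c f =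
    sym (trans (*-distribˡ-sum c (sum ∘ f)) (sum-cong-≗ (λ i → *-distribˡ-sum c (f i))))

  sum²-product : ∀ {m n} (f : Fin m → ℕ) (g : Fin n → ℕ) →
    sum (λ i → sum (λ j → f i * g j)) ≡ sum f * sum g
  sum²-product f g =
    sym (trans (*-distribʳ-sum (sum g) f) (sum-cong-≗ (λ i → *-distribˡ-sum (f i) g)))

  sum³-rotate : ∀ {l m n} (f : Fin l → Fin m → Fin n → ℕ) →
    sum (λ x → sum (λ y → sum (λ z → f x y z))) ≡ sum (λ y → sum (λ z → sum (λ x → f x y z)))
  sum³-rotate f = trans (∑-comm (λ x y → sum (f x y))) (sum-cong-≗ (λ y → ∑-comm (λ x z → f x y z)))

  -- With the larger number written as the smaller plus `k`, the two sides differ by `k * k`; this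
  -- stands in for (a - b)² ≥ 0, where truncated subtraction would lose the sign.
  2ab≤a²+b² : ∀ a b → 2 * (a * b) ≤ a * a + b * b
  2ab≤a²+b² a b with ≤-total a b
  ... | inj₁ a≤b = subst (λ b → 2 * (a * b) ≤ a * a + b * b) (m+[n∸m]≡n a≤b)
                     (≤-trans (m≤m+n _ _) (≤-reflexive (identity a (b ∸ a))))
    where
    identity : ∀ a k → 2 * (a * (a + k)) + k * k ≡ a * a + (a + k) * (a + k)
    identity = solve-∀
  ... | inj₂ b≤a = subst (λ a → 2 * (a * b) ≤ a * a + b * b) (m+[n∸m]≡n b≤a)
                     (≤-trans (m≤m+n _ _) (≤-reflexive (identity b (a ∸ b))))
    where
    identity : ∀ b k → 2 * ((b + k) * b) + k * k ≡ (b + k) * (b + k) + b * b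
    identity = solve-∀

  [a+b+c]²≤3[a²+b²+c²] : ∀ a b c →
    (a + b + c) * (a + b + c) ≤ 3 * (a * a + b * b + c * c)
  [a+b+c]²≤3[a²+b²+c²] a b c = begin
    (a + b + c) * (a + b + c)
      ≡⟨ expand a b c ⟩
    a * a + b * b + c * c + (2 * (a * b) + 2 * (b * c) + 2 * (a * c))
      ≤⟨ +-monoʳ-≤ (a * a + b * b + c * c) (+-mono-≤ (+-mono-≤ (2ab≤a²+b² a b) (2ab≤a²+b² b c)) (2ab≤a²+b² a c)) ⟩
    a * a + b * b + c * c + (a * a + b * b + (b * b + c * c) + (a * a + c * c))
      ≡⟨ collect a b c ⟩
    3 * (a * a + b * b + c * c) ∎
    where
    open ≤-Reasoning
    expand : ∀ a b c → (a + b + c) * (a + b + c) ≡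
      a * a + b * b + c * c + (2 * (a * b) + 2 * (b * c) + 2 * (a * c))
    expand = solve-∀
    collect : ∀ a b c → a * a + b * b + c * c + (a * a + b * b + (b * b + c * c) + (a * a + c * c))
      ≡ 3 * (a * a + b * b + c * c)
    collect = solve-∀

  -- 2n³ − 3mn² + m³ = (n − m)²(2n + m).
  3mn²≤2n³+m³ : ∀ {m n} → m ≤ n → 3 * (m * (n * n)) ≤ 2 * (n * n * n) + m * m * m
  3mn²≤2n³+m³ {m} {n} m≤n =
    subst (λ n → 3 * (m * (n * n)) ≤ 2 * (n * n * n) + m * m * m) (m+[n∸m]≡n m≤n)
      (≤-trans (m≤m+n _ _) (≤-reflexive (identity m (n ∸ m))))
    where
    identity : ∀ m k → 3 * (m * ((m + k) * (m + k))) + k * k * (2 * (m + k) + m) ≡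
      2 * ((m + k) * (m + k) * (m + k)) + m * m * m
    identity = solve-∀

  largest-below : ∀ {p} {P : ℕ → Set p} → Decidable P → P 0 → ∀ n →
    Σ ℕ λ M → M ≤ n × P M × (∀ m → m ≤ n → P m → m ≤ M)
  largest-below P? P0 zero = 0 , z≤n , P0 , λ m m≤0 _ → m≤0
  largest-below {P = P} P? P0 (suc n) with P? (suc n)
  ... | yes Psn = suc n , ≤-refl , Psn , λ m m≤ _ → m≤
  ... | no ¬Psn with M , M≤n , PM , max ← largest-below P? P0 n =
    M , m≤n⇒m≤1+n M≤n , PM , λ m m≤sn Pm → max m (≤-pred (≤∧≢⇒< m≤sn (λ { refl → ¬Psn Pm }))) Pm

  -- The bound on the number of ordered triples

  ⟦_⟧ : Bool → ℕ
  ⟦ true  ⟧ = 1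
  ⟦ false ⟧ = 0

  ⟦⟧≤1 : ∀ b → ⟦ b ⟧ ≤ 1
  ⟦⟧≤1 true  = ≤-refl
  ⟦⟧≤1 false = z≤n

  -- t and e are the indicators of ordered triples and ordered pairs.
  module Cancellative {n : ℕ} (t : Fin n → Fin n → Fin n → Bool) (e : Fin n → Fin n → Bool)
    (t-rotate : ∀ {x y z} → t x y z ≡ true → t y z x ≡ true)
    (t-swap : ∀ {x y z} → t x y z ≡ true → t y x z ≡ true)
    (t⇒e : ∀ {x y z} → t x y z ≡ true → e x y ≡ true)
    (independent : ∀ {x y a b} → t x y a ≡ true → t x y b ≡ true → e a b ≡ true → ⊥)
    where

    T : Fin n → Fin n → Fin n → ℕ
    T x y z = ⟦ t x y z ⟧

    T-rotate : ∀ x y z → T x y z ≡ T y z x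
    T-rotate x y z with t x y z in p | t y z x in q
    ... | true  | true  = refl
    ... | false | false = refl
    ... | true  | false = trans (cong ⟦_⟧ (sym (t-rotate p))) (cong ⟦_⟧ q)
    ... | false | true  = trans (cong ⟦_⟧ (sym p)) (cong ⟦_⟧ (t-rotate (t-rotate q)))

    codegree : Fin n → Fin n → ℕ
    codegree x y = sum (T x y)

    triples : ℕ
    triples = sum λ x → sum λ y → sum λ z → T x y z

    pairs : ℕ
    pairs = sum λ x → sum λ y → ⟦ e x y ⟧

    codegree² : ℕ
    codegree² = sum λ x → sum λ y → codegree x y * codegree x y

    -- A common element w of N(xy) and N(yz) would put x and z into N(yw), although zx is a pair
    -- because xyz is a triple.
    disjoint : ∀ {x y z w} → t x y z ≡ true → t x y w ≡ true → t y z w ≡ true → ⊥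
    disjoint xyz xyw yzw = independent (t-rotate (t-swap yzw)) (t-rotate xyw)
      (t⇒e (t-rotate (t-rotate xyz)))

    weight : Fin n → Fin n → Fin n → ℕ
    weight x y z = codegree x y + codegree y z + codegree z x

    weight≤n : ∀ {x y z} → t x y z ≡ true → weight x y z ≤ n
    weight≤n {x} {y} {z} xyz = begin
      weight x y z
        ≡⟨ cong (_+ codegree z x) (∑-distrib-+ (T x y) (T y z)) ⟨
      sum (λ w → T x y w + T y z w) + codegree z x
        ≡⟨ ∑-distrib-+ (λ w → T x y w + T y z w) (T z x) ⟨
      sum (λ w → T x y w + T y z w + T z x w)
        ≤⟨ sum-mono pointwise ⟩
      sum {n} (λ _ → 1)
        ≡⟨ sum-1 n ⟩
      n ∎
      where
      open ≤-Reasoning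
      pointwise : ∀ w → T x y w + T y z w + T z x w ≤ 1
      pointwise w with t x y w in p | t y z w in q | t z x w in r
      ... | true  | true  | _     = ⊥-elim (disjoint xyz p q)
      ... | true  | false | true  = ⊥-elim (disjoint (t-rotate (t-rotate xyz)) r p)
      ... | false | true  | true  = ⊥-elim (disjoint (t-rotate xyz) q r)
      ... | true  | false | false = ≤-refl
      ... | false | true  | false = ≤-refl
      ... | false | false | true  = ≤-refl
      ... | false | false | false = z≤n

    -- Each codegree square counts the ordered pairs (u, v) inside one of the neighbourhoods N(xy),
    -- N(yz), N(zx). By disjointness the three squares do not overlap, and by independence none of
    -- them meets the relation `e`, so each (u, v) is counted at most once on the left.
    pairs+codegrees²≤n² : ∀ {x y z} → t x y z ≡ true →
      pairs + (codegree x y * codegree x y + codegree y z * codegree y z + codegree z x * codegree z x)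
        ≤ n * n
    pairs+codegrees²≤n² {x} {y} {z} xyz = begin
      pairs + (codegree x y * codegree x y + codegree y z * codegree y z + codegree z x * codegree z x)
        ≡⟨ cong (pairs +_) (cong₂ _+_ (cong₂ _+_ (sum²-product (T x y) (T x y)) (sum²-product (T y z) (T y z))) (sum²-product (T z x) (T z x))) ⟨
      pairs + (sum (λ u → sum (λ v → T x y u * T x y v)) + sum (λ u → sum (λ v → T y z u * T y z v))
        + sum (λ u → sum (λ v → T z x u * T z x v)))
        ≡⟨ cong (λ s → pairs + (s + sum (λ u → sum (λ v → T z x u * T z x v)))) (sum²-distrib-+ (λ u v → T x y u * T x y v) (λ u v → T y z u * T y z v)) ⟨
      pairs + (sum (λ u → sum (λ v → T x y u * T x y v + T y z u * T y z v))
        + sum (λ u → sum (λ v → T z x u * T z x v)))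
        ≡⟨ cong (pairs +_) (sum²-distrib-+ (λ u v → T x y u * T x y v + T y z u * T y z v) (λ u v → T z x u * T z x v)) ⟨
      pairs + sum (λ u → sum (λ v → T x y u * T x y v + T y z u * T y z v + T z x u * T z x v))
        ≡⟨ sum²-distrib-+ (λ u v → ⟦ e u v ⟧) (λ u v → T x y u * T x y v + T y z u * T y z v + T z x u * T z x v) ⟨
      sum (λ u → sum (λ v → ⟦ e u v ⟧ + (T x y u * T x y v + T y z u * T y z v + T z x u * T z x v)))
        ≤⟨ sum²-mono pointwise ⟩
      sum {n} (λ _ → sum {n} (λ _ → 1))
        ≡⟨ sum²-1 n ⟩
      n * n ∎
      where
      open ≤-Reasoning
      yzx : t y z x ≡ true
      yzx = t-rotate xyz
      zxy : t z x y ≡ true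
      zxy = t-rotate yzx
      pointwise : ∀ u v → ⟦ e u v ⟧ + (T x y u * T x y v + T y z u * T y z v + T z x u * T z x v) ≤ 1
      pointwise u v with t x y u in a | t y z u in b | t z x u in c
      ... | true  | true  | _     = ⊥-elim (disjoint xyz a b)
      ... | true  | false | true  = ⊥-elim (disjoint zxy c a)
      ... | false | true  | true  = ⊥-elim (disjoint yzx b c)
      -- From here on u lies in at most one neighbourhood, so the other products vanish and only v
      -- and `e u v` remain to be tested.
      pointwise u v | false | false | false with e u v
      ... | true  = ≤-refl
      ... | false = z≤n
      pointwise u v | true | false | false with e u v in uv | t x y v in a′
      ... | true  | true  = ⊥-elim (independent a a′ uv)
      ... | true  | false = ≤-refl
      ... | false | true  = ≤-refl
      ... | false | false = z≤n
      pointwise u v | false | true | false with e u v in uv | t y z v in b′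
      ... | true  | true  = ⊥-elim (independent b b′ uv)
      ... | true  | false = ≤-refl
      ... | false | true  = ≤-refl
      ... | false | false = z≤n
      pointwise u v | false | false | true with e u v in uv | t z x v in c′
      ... | true  | true  = ⊥-elim (independent c c′ uv)
      ... | true  | false = ≤-refl
      ... | false | true  = ≤-refl
      ... | false | false = z≤n

    -- The quadratic mean inequality merges the three squares. The result involves the triple only
    -- through its weight, so it can serve as the predicate that selects M.
    3pairs+weight²≤3n² : ∀ {x y z} → t x y z ≡ true →
      3 * pairs + weight x y z * weight x y z ≤ 3 * (n * n)
    3pairs+weight²≤3n² {x} {y} {z} xyz = begin
      3 * pairs + weight x y z * weight x y z
        ≤⟨ +-monoʳ-≤ (3 * pairs) ([a+b+c]²≤3[a²+b²+c²] (codegree x y) (codegree y z) (codegree z x)) ⟩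
      3 * pairs + 3 * (codegree x y * codegree x y + codegree y z * codegree y z + codegree z x * codegree z x)
        ≡⟨ *-distribˡ-+ 3 pairs _ ⟨
      3 * (pairs + (codegree x y * codegree x y + codegree y z * codegree y z + codegree z x * codegree z x))
        ≤⟨ *-monoʳ-≤ 3 (pairs+codegrees²≤n² xyz) ⟩
      3 * (n * n) ∎
      where open ≤-Reasoning

    private
      D : Fin n → Fin n → ℕ
      D = codegree

      sum-T*D-xy : sum (λ x → sum (λ y → sum (λ z → T x y z * D x y))) ≡ codegree²
      sum-T*D-xy = sum²-cong (λ x y → sym (*-distribʳ-sum (D x y) (T x y)))

      sum-T*D-yz : sum (λ x → sum (λ y → sum (λ z → T x y z * D y z))) ≡ codegree²
      sum-T*D-yz = trans (sum³-rotate (λ x y z → T x y z * D y z))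
        (trans (sum²-cong (λ y z → sum-cong-≗ (λ x → cong (_* D y z) (T-rotate x y z)))) sum-T*D-xy)

      sum-T*D-zx : sum (λ x → sum (λ y → sum (λ z → T x y z * D z x))) ≡ codegree²
      sum-T*D-zx = trans (sum³-rotate (λ x y z → T x y z * D z x))
        (trans (sum²-cong (λ y z → sum-cong-≗ (λ x → cong (_* D z x) (T-rotate x y z)))) sum-T*D-yz)

    -- Double counting: for fixed x and y the term `D x y` is summed once for each z in N(xy), which
    -- gives its square. The other two terms reduce to this one by rotating the summation variables,
    -- since `T` is invariant under rotation.
    sum-T*weight : sum (λ x → sum (λ y → sum (λ z → T x y z * weight x y z))) ≡ 3 * codegree²
    sum-T*weight = begin
      sum (λ x → sum (λ y → sum (λ z → T x y z * weight x y z)))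
        ≡⟨ sum²-cong (λ x y → trans (sum-cong-≗ (λ z → distrib (T x y z) (D x y) (D y z) (D z x)))
             (trans (∑-distrib-+ (λ z → T x y z * D x y + T x y z * D y z) (λ z → T x y z * D z x))
               (cong (_+ sum (λ z → T x y z * D z x)) (∑-distrib-+ (λ z → T x y z * D x y) (λ z → T x y z * D y z))))) ⟩
      sum (λ x → sum (λ y → sum (λ z → T x y z * D x y) + sum (λ z → T x y z * D y z) + sum (λ z → T x y z * D z x)))
        ≡⟨ sum²-distrib-+ (λ x y → sum (λ z → T x y z * D x y) + sum (λ z → T x y z * D y z)) (λ x y → sum (λ z → T x y z * D z x)) ⟩
      sum (λ x → sum (λ y → sum (λ z → T x y z * D x y) + sum (λ z → T x y z * D y z)))
        + sum (λ x → sum (λ y → sum (λ z → T x y z * D z x)))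
        ≡⟨ cong₂ _+_ (trans (sum²-distrib-+ (λ x y → sum (λ z → T x y z * D x y)) (λ x y → sum (λ z → T x y z * D y z)))
             (cong₂ _+_ sum-T*D-xy sum-T*D-yz)) sum-T*D-zx ⟩
      codegree² + codegree² + codegree²
        ≡⟨ thrice codegree² ⟩
      3 * codegree² ∎
      where
      open ≡-Reasoning
      distrib : ∀ t a b c → t * (a + b + c) ≡ t * a + t * b + t * c
      distrib = solve-∀
      thrice : ∀ a → a + a + a ≡ 3 * a
      thrice = solve-∀

    3codegree²≤M*triples : ∀ {M} → (∀ {x y z} → t x y z ≡ true → weight x y z ≤ M) →
      3 * codegree² ≤ M * triples
    3codegree²≤M*triples {M} bound = begin
      3 * codegree²
        ≡⟨ sum-T*weight ⟨
      sum (λ x → sum (λ y → sum (λ z → T x y z * weight x y z)))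
        ≤⟨ sum²-mono (λ x y → sum-mono (pointwise x y)) ⟩
      sum (λ x → sum (λ y → sum (λ z → M * T x y z)))
        ≡⟨ sum²-cong (λ x y → sym (*-distribˡ-sum M (T x y))) ⟩
      sum (λ x → sum (λ y → M * D x y))
        ≡⟨ sum²-distribˡ-* M D ⟩
      M * triples ∎
      where
      open ≤-Reasoning
      pointwise : ∀ x y z → T x y z * weight x y z ≤ M * T x y z
      pointwise x y z with t x y z in xyz
      ... | true  = ≤-trans (≤-reflexive (+-identityʳ _)) (≤-trans (bound xyz) (≤-reflexive (sym (*-identityʳ M))))
      ... | false = z≤n

    -- Non-pairs contribute nothing, so the Cauchy-Schwarz bound below carries the factor `pairs`
    -- instead of n².
    codegree≡0 : ∀ {x y} → e x y ≡ false → codegree x y ≡ 0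
    codegree≡0 {x} {y} ¬xy = n≤0⇒n≡0 (≤-trans (sum-mono pointwise) (≤-reflexive (trans (sum-const n 0) (*-zeroʳ n))))
      where
      pointwise : ∀ z → T x y z ≤ 0
      pointwise z with t x y z in xyz
      ... | false = z≤n
      ... | true with () ← trans (sym (t⇒e xyz)) ¬xy

    -- Cauchy–Schwarz for codegrees, linearised around the value M / 3.
    6M*triples≤9codegree²+M²pairs : ∀ M → 6 * M * triples ≤ 9 * codegree² + M * M * pairs
    6M*triples≤9codegree²+M²pairs M = begin
      6 * M * triples
        ≡⟨ sum²-distribˡ-* (6 * M) D ⟨
      sum (λ x → sum (λ y → 6 * M * D x y))
        ≤⟨ sum²-mono pointwise ⟩
      sum (λ x → sum (λ y → 9 * (D x y * D x y) + M * M * ⟦ e x y ⟧))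
        ≡⟨ sum²-distrib-+ (λ x y → 9 * (D x y * D x y)) (λ x y → M * M * ⟦ e x y ⟧) ⟩
      sum (λ x → sum (λ y → 9 * (D x y * D x y))) + sum (λ x → sum (λ y → M * M * ⟦ e x y ⟧))
        ≡⟨ cong₂ _+_ (sum²-distribˡ-* 9 (λ x y → D x y * D x y)) (sum²-distribˡ-* (M * M) (λ x y → ⟦ e x y ⟧)) ⟩
      9 * codegree² + M * M * pairs ∎
      where
      open ≤-Reasoning
      square : ∀ d → 6 * M * d ≤ 9 * (d * d) + M * M * 1
      square d = subst₂ _≤_ (lhs d M) (rhs d M) (2ab≤a²+b² (3 * d) M)
        where
        lhs : ∀ d M → 2 * (3 * d * M) ≡ 6 * M * d
        lhs = solve-∀
        rhs : ∀ d M → 3 * d * (3 * d) + M * M ≡ 9 * (d * d) + M * M * 1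
        rhs = solve-∀
      pointwise : ∀ x y → 6 * M * D x y ≤ 9 * (D x y * D x y) + M * M * ⟦ e x y ⟧
      pointwise x y with e x y in xy
      ... | true  = square (D x y)
      ... | false = ≤-trans (≤-reflexive (trans (cong (6 * M *_) (codegree≡0 xy)) (*-zeroʳ (6 * M)))) z≤n

    -- Serves the case M = 0 below, where the factor M cannot be cancelled.
    triples≤codegree² : triples ≤ codegree²
    triples≤codegree² = sum²-mono (λ x y → m≤m*m (D x y))
      where
      m≤m*m : ∀ m → m ≤ m * m
      m≤m*m zero    = z≤n
      m≤m*m (suc m) = m≤m*n (suc m) (suc m)

    -- Inserting 3 · codegree² ≤ M · triples into the linearised Cauchy-Schwarz bound gives 6M ·
    -- triples ≤ 3M · triples + M² · pairs. Subtracting 3M · triples and cancelling M leaves the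
    -- claim.
    3triples≤M*pairs : ∀ M → (∀ {x y z} → t x y z ≡ true → weight x y z ≤ M) → 3 * triples ≤ M * pairs
    3triples≤M*pairs zero bound = ≤-trans (*-monoʳ-≤ 3 triples≤codegree²) (3codegree²≤M*triples bound)
    3triples≤M*pairs M@(suc _) bound = *-cancelˡ-≤ M (+-cancelˡ-≤ (3 * (M * triples)) _ _ (begin
      3 * (M * triples) + M * (3 * triples)
        ≡⟨ lhs M triples ⟩
      6 * M * triples
        ≤⟨ 6M*triples≤9codegree²+M²pairs M ⟩
      9 * codegree² + M * M * pairs
        ≡⟨ cong₂ _+_ (*-assoc 3 3 codegree²) (*-assoc M M pairs) ⟩
      3 * (3 * codegree²) + M * (M * pairs)
        ≤⟨ +-monoˡ-≤ _ (*-monoʳ-≤ 3 (3codegree²≤M*triples bound)) ⟩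
      3 * (M * triples) + M * (M * pairs) ∎))
      where
      open ≤-Reasoning
      lhs : ∀ M s → 3 * (M * s) + M * (3 * s) ≡ 6 * M * s
      lhs = solve-∀

    pairs≤n² : pairs ≤ n * n
    pairs≤n² = begin
      pairs                               ≤⟨ sum²-mono (λ x y → ⟦⟧≤1 (e x y)) ⟩
      sum {n} (λ _ → sum {n} (λ _ → 1))   ≡⟨ sum²-1 n ⟩
      n * n                               ∎
      where open ≤-Reasoning

    -- M is not the maximal weight itself but the largest number obeying the bound that all weights
    -- obey, which avoids a search over triples.
    9triples≤2n³ : 9 * triples ≤ 2 * (n * n * n)
    9triples≤2n³
      with M , M≤n , PM , max ← largest-below (λ m → 3 * pairs + m * m ≤? 3 * (n * n))
             (subst (_≤ 3 * (n * n)) (sym (+-identityʳ (3 * pairs))) (*-monoʳ-≤ 3 pairs≤n²)) n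
      -- M³ is added on both sides so that M(3n² - M²) ≤ 2n³ is reached without subtraction.
      = +-cancelʳ-≤ (M * M * M) _ _ (begin
      9 * triples + M * M * M
        ≡⟨ cong (_+ M * M * M) (*-assoc 3 3 triples) ⟩
      3 * (3 * triples) + M * M * M
        -- The weight of a triple is at most n and satisfies the predicate, so maximality of M
        -- bounds it by M.
        ≤⟨ +-monoˡ-≤ _ (*-monoʳ-≤ 3 (3triples≤M*pairs M (λ xyz → max _ (weight≤n xyz) (3pairs+weight²≤3n² xyz)))) ⟩
      3 * (M * pairs) + M * M * M
        ≡⟨ factor M pairs ⟩
      M * (3 * pairs + M * M)
        ≤⟨ *-monoʳ-≤ M PM ⟩
      M * (3 * (n * n))
        ≡⟨ commute M n ⟩
      3 * (M * (n * n))
        ≤⟨ 3mn²≤2n³+m³ M≤n ⟩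
      2 * (n * n * n) + M * M * M ∎)
      where
      open ≤-Reasoning
      factor : ∀ M q → 3 * (M * q) + M * M * M ≡ M * (3 * q + M * M)
      factor = solve-∀
      commute : ∀ M n → M * (3 * (n * n)) ≡ 3 * (M * (n * n))
      commute = solve-∀

  -- Edge counts in terms of ordered pairs and triples

  length-filterᵇ-map : ∀ {A B : Set} (f : A → B) (p : B → Bool) xs →
    length (filterᵇ p (map f xs)) ≡ length (filterᵇ (p ∘ f) xs)
  length-filterᵇ-map f p []       = refl
  length-filterᵇ-map f p (x ∷ xs) with p (f x)
  ... | true  = cong suc (length-filterᵇ-map f p xs)
  ... | false = length-filterᵇ-map f p xs

  link deletion : ∀ {n} → Family (suc n) → Family n
  link     E A = E (inside ∷ A)
  deletion E A = E (outside ∷ A)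

  -- Drives the counts below, which go by induction on the number of vertices: edges through vertex
  -- zero are recorded by the link, where sizes drop by one.
  numEdges-suc : ∀ {n} (E : Family (suc n)) → numEdges E ≡ numEdges (link E) + numEdges (deletion E)
  numEdges-suc {n} E = begin
    length (filterᵇ E (map (inside ∷_) (allSubsets n) ++ map (outside ∷_) (allSubsets n)))
      ≡⟨ cong length (filter-++ (T? ∘ E) (map (inside ∷_) (allSubsets n)) _) ⟩
    length (filterᵇ E (map (inside ∷_) (allSubsets n)) ++ filterᵇ E (map (outside ∷_) (allSubsets n)))
      ≡⟨ length-++ (filterᵇ E (map (inside ∷_) (allSubsets n))) ⟩
    length (filterᵇ E (map (inside ∷_) (allSubsets n))) + length (filterᵇ E (map (outside ∷_) (allSubsets n)))
      ≡⟨ cong₂ _+_ (length-filterᵇ-map (inside ∷_) E (allSubsets n)) (length-filterᵇ-map (outside ∷_) E (allSubsets n)) ⟩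
    numEdges (link E) + numEdges (deletion E) ∎
    where open ≡-Reasoning

  numEdges≤1 : (E : Family 0) → numEdges E ≤ 1
  numEdges≤1 E with E []
  ... | true  = ≤-refl
  ... | false = z≤n

  SizesAtMost : ∀ {n} → ℕ → Family n → Set
  SizesAtMost k E = ∀ A → IsEdge E A → ∣ A ∣ ≤ k

  link-sizes : ∀ {n k} {E : Family (suc n)} → SizesAtMost (suc k) E → SizesAtMost k (link E)
  link-sizes small A EA = ≤-pred (small (inside ∷ A) EA)

  deletion-sizes : ∀ {n k} {E : Family (suc n)} → SizesAtMost k E → SizesAtMost k (deletion E)
  deletion-sizes small A EA = small (outside ∷ A) EA

  numEdges-empty : ∀ {n} (E : Family n) → (∀ A → E A ≡ false) → numEdges E ≡ 0
  numEdges-empty {zero}  E none rewrite none [] = refl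
  numEdges-empty {suc n} E none = trans (numEdges-suc E)
    (cong₂ _+_ (numEdges-empty (link E) (none ∘ (inside ∷_))) (numEdges-empty (deletion E) (none ∘ (outside ∷_))))

  numEdges-sizes≤0 : ∀ {n} (E : Family n) → SizesAtMost 0 E → numEdges E ≤ ⟦ E ∅ ⟧
  numEdges-sizes≤0 {zero}  E small with E []
  ... | true  = ≤-refl
  ... | false = z≤n
  numEdges-sizes≤0 {suc n} E small = begin
    numEdges E                                ≡⟨ numEdges-suc E ⟩
    numEdges (link E) + numEdges (deletion E) ≡⟨ cong (_+ numEdges (deletion E)) (numEdges-empty (link E) none) ⟩
    numEdges (deletion E)                     ≤⟨ numEdges-sizes≤0 (deletion E) (deletion-sizes small) ⟩
    ⟦ E ∅ ⟧                                   ∎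
    where
    open ≤-Reasoning
    none : ∀ A → link E A ≡ false
    none A with link E A in EA
    ... | false = refl
    ... | true with () ← small (inside ∷ A) EA

  numEdges-sizes≤1 : ∀ {n} (E : Family n) → SizesAtMost 1 E → numEdges E ≤ 1 + sum (λ x → ⟦ E ⁅ x ⁆ ⟧)
  numEdges-sizes≤1 {zero}  E small = numEdges≤1 E
  numEdges-sizes≤1 {suc n} E small = begin
    numEdges E
      ≡⟨ numEdges-suc E ⟩
    numEdges (link E) + numEdges (deletion E)
      ≤⟨ +-mono-≤ (numEdges-sizes≤0 (link E) (link-sizes small)) (numEdges-sizes≤1 (deletion E) (deletion-sizes small)) ⟩
    ⟦ E ⁅ zero ⁆ ⟧ + (1 + sum (λ x → ⟦ E ⁅ suc x ⁆ ⟧))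
      ≡⟨ +-suc ⟦ E ⁅ zero ⁆ ⟧ _ ⟩
    1 + sum (λ x → ⟦ E ⁅ x ⁆ ⟧) ∎
    where open ≤-Reasoning

  distinct : ∀ {n} → Fin n → Fin n → Bool
  distinct x y = not (does (x ≟ y))

  -- `distinct` keeps out the diagonal, where `⁅ x ⁆ ∪ ⁅ x ⁆` is a singleton and would count
  -- singleton edges as pairs.
  pair : ∀ {n} → Family n → Fin n → Fin n → Bool
  pair E x y = distinct x y ∧ E (⁅ x ⁆ ∪ ⁅ y ⁆)

  triple : ∀ {n} → Family n → Fin n → Fin n → Fin n → Bool
  triple E x y z = distinct x y ∧ distinct y z ∧ distinct x z ∧ E (⁅ x ⁆ ∪ (⁅ y ⁆ ∪ ⁅ z ⁆))

  #pairs #triples : ∀ {n} → Family n → ℕ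
  #pairs   E = sum λ x → sum λ y → ⟦ pair E x y ⟧
  #triples E = sum λ x → sum λ y → sum λ z → ⟦ triple E x y z ⟧

  -- Vertex zero may stand in either place of an ordered pair, and each place contributes the
  -- singletons of the link; the pairs avoiding zero are those of the deletion.
  #pairs-suc : ∀ {n} (E : Family (suc n)) →
    2 * sum (λ x → ⟦ link E ⁅ x ⁆ ⟧) + #pairs (deletion E) ≤ #pairs E
  #pairs-suc {n} E = begin
    2 * s + #pairs (deletion E)
      ≡⟨ rearrange s (#pairs (deletion E)) ⟩
    s + (s + #pairs (deletion E))
      ≡⟨ cong₂ _+_ (sum-cong-≗ {n} (λ y → cong (⟦_⟧ ∘ link E) (sym (∪-identityˡ ⁅ y ⁆))))
           (trans (cong (_+ #pairs (deletion E)) (sum-cong-≗ {n} (λ x → cong (⟦_⟧ ∘ link E) (sym (∪-identityʳ ⁅ x ⁆)))))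
             (sym (∑-distrib-+ {n} (λ x → ⟦ pair E (suc x) zero ⟧) (λ x → sum (λ y → ⟦ pair E (suc x) (suc y) ⟧))))) ⟩
    #pairs E ∎
    where
    open ≤-Reasoning
    s : ℕ
    s = sum (λ x → ⟦ link E ⁅ x ⁆ ⟧)
    rearrange : ∀ a b → 2 * a + b ≡ a + (a + b)
    rearrange = solve-∀

  -- Vertex zero may stand in any of three places, leaving an ordered pair of the link in the other
  -- two.
  #triples-suc : ∀ {n} (E : Family (suc n)) → 3 * #pairs (link E) + #triples (deletion E) ≤ #triples E
  #triples-suc {n} E = begin
    3 * #pairs (link E) + #triples (deletion E)
      ≡⟨ rearrange (#pairs (link E)) (#triples (deletion E)) ⟩
    #pairs (link E) + (#pairs (link E) + (#pairs (link E) + #triples (deletion E)))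
      ≡⟨ cong₂ _+_ (sum²-cong (λ y z → cong (λ A → ⟦ distinct y z ∧ link E A ⟧) (sym (∪-identityˡ (⁅ y ⁆ ∪ ⁅ z ⁆)))))
          (cong₂ _+_ (sum²-cong (λ x z → cong (λ A → ⟦ distinct x z ∧ link E (⁅ x ⁆ ∪ A) ⟧) (sym (∪-identityˡ ⁅ z ⁆))))
            (trans (cong (_+ #triples (deletion E)) (sum²-cong (λ x y → cong (λ A → ⟦ distinct x y ∧ link E (⁅ x ⁆ ∪ A) ⟧) (sym (∪-identityʳ ⁅ y ⁆)))))
              (sym (sum²-distrib-+ {n} {n} (λ x y → t (suc x) (suc y) zero) (λ x y → sum (λ z → t (suc x) (suc y) (suc z))))))) ⟩
    sum (λ y → sum (λ z → t zero (suc y) (suc z)))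
      + (sum (λ x → sum (λ z → t (suc x) zero (suc z)))
        + sum (λ x → sum (λ y → sum (λ z → t (suc x) (suc y) z))))
      ≡⟨ cong (sum (λ y → sum (λ z → t zero (suc y) (suc z))) +_)
           (∑-distrib-+ {n} (λ x → sum (λ z → t (suc x) zero (suc z))) (λ x → sum (λ y → sum (λ z → t (suc x) (suc y) z)))) ⟨
    sum (λ y → sum (λ z → t zero (suc y) (suc z)))
      + sum (λ x → sum (λ z → t (suc x) zero (suc z)) + sum (λ y → sum (λ z → t (suc x) (suc y) z)))
      -- The discarded terms are those in which vertex zero occurs at least twice.
      ≤⟨ +-mono-≤ (≤-trans (sum-mono {n} (λ y → m≤n+m _ (t zero (suc y) zero))) (m≤n+m _ (sum (t zero zero))))
           (sum-mono {n} (λ x → +-monoˡ-≤ (sum (λ y → sum (t (suc x) (suc y)))) (m≤n+m _ (t (suc x) zero zero)))) ⟩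
    #triples E ∎
    where
    open ≤-Reasoning
    t : Fin (suc n) → Fin (suc n) → Fin (suc n) → ℕ
    t x y z = ⟦ triple E x y z ⟧
    rearrange : ∀ a b → 3 * a + b ≡ a + (a + (a + b))
    rearrange = solve-∀

  -- An edge of size two gives two ordered pairs; `1 + n` allows for the empty set and the
  -- singletons.
  numEdges-sizes≤2 : ∀ {n} (E : Family n) → SizesAtMost 2 E → 2 * numEdges E ≤ 2 * (1 + n) + #pairs E
  numEdges-sizes≤2 {zero}  E small = *-monoʳ-≤ 2 (numEdges≤1 E)
  numEdges-sizes≤2 {suc n} E small = begin
    2 * numEdges E
      ≡⟨ cong (2 *_) (numEdges-suc E) ⟩
    2 * (numEdges (link E) + numEdges (deletion E))
      ≡⟨ *-distribˡ-+ 2 (numEdges (link E)) _ ⟩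
    2 * numEdges (link E) + 2 * numEdges (deletion E)
      ≤⟨ +-mono-≤ (*-monoʳ-≤ 2 (numEdges-sizes≤1 (link E) (link-sizes small))) (numEdges-sizes≤2 (deletion E) (deletion-sizes small)) ⟩
    2 * (1 + s) + (2 * (1 + n) + #pairs (deletion E))
      ≡⟨ rearrange n s (#pairs (deletion E)) ⟩
    2 * (2 + n) + (2 * s + #pairs (deletion E))
      ≤⟨ +-monoʳ-≤ (2 * (2 + n)) (#pairs-suc E) ⟩
    2 * (2 + n) + #pairs E ∎
    where
    open ≤-Reasoning
    s : ℕ
    s = sum (λ x → ⟦ link E ⁅ x ⁆ ⟧)
    rearrange : ∀ n s p → 2 * (1 + s) + (2 * (1 + n) + p) ≡ 2 * (2 + n) + (2 * s + p)
    rearrange = solve-∀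

  -- An edge of size three gives six ordered triples; `1 + n + n * n` allows crudely for all smaller
  -- edges.
  numEdges-sizes≤3 : ∀ {n} (E : Family n) → SizesAtMost 3 E →
    6 * numEdges E ≤ 6 * (1 + n + n * n) + #triples E
  numEdges-sizes≤3 {zero}  E small = *-monoʳ-≤ 6 (numEdges≤1 E)
  numEdges-sizes≤3 {suc n} E small = begin
    6 * numEdges E
      ≡⟨ cong (6 *_) (numEdges-suc E) ⟩
    6 * (numEdges (link E) + numEdges (deletion E))
      ≡⟨ distrib (numEdges (link E)) (numEdges (deletion E)) ⟩
    3 * (2 * numEdges (link E)) + 6 * numEdges (deletion E)
      ≤⟨ +-mono-≤ (*-monoʳ-≤ 3 (numEdges-sizes≤2 (link E) (link-sizes small))) (numEdges-sizes≤3 (deletion E) (deletion-sizes small)) ⟩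
    3 * (2 * (1 + n) + #pairs (link E)) + (6 * (1 + n + n * n) + #triples (deletion E))
      ≤⟨ m≤m+n _ (6 * (1 + n)) ⟩
    3 * (2 * (1 + n) + #pairs (link E)) + (6 * (1 + n + n * n) + #triples (deletion E)) + 6 * (1 + n)
      ≡⟨ rearrange n (#pairs (link E)) (#triples (deletion E)) ⟩
    6 * (1 + suc n + suc n * suc n) + (3 * #pairs (link E) + #triples (deletion E))
      ≤⟨ +-monoʳ-≤ (6 * (1 + suc n + suc n * suc n)) (#triples-suc E) ⟩
    6 * (1 + suc n + suc n * suc n) + #triples E ∎
    where
    open ≤-Reasoning
    distrib : ∀ a b → 6 * (a + b) ≡ 3 * (2 * a) + 6 * b
    distrib = solve-∀
    rearrange : ∀ n p t → 3 * (2 * (1 + n) + p) + (6 * (1 + n + n * n) + t) + 6 * (1 + n) ≡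
      6 * (1 + (1 + n) + (1 + n) * (1 + n)) + (3 * p + t)
    rearrange = solve-∀

  -- The hypotheses of the triple bound for an F-free complex

  ∧-true⁻ : ∀ {a b} → a ∧ b ≡ true → a ≡ true × b ≡ true
  ∧-true⁻ {true} {true} refl = refl , refl

  distinct⁻ : ∀ {n} {x y : Fin n} → distinct x y ≡ true → x ≢ y
  distinct⁻ {x = x} {y} p with x ≟ y
  ... | no x≢y = x≢y

  distinct⁺ : ∀ {n} {x y : Fin n} → x ≢ y → distinct x y ≡ true
  distinct⁺ {x = x} {y} x≢y = cong not (dec-false (x ≟ y) x≢y)

  pair⁻ : ∀ {n} {E : Family n} {x y} → pair E x y ≡ true → x ≢ y × IsEdge E (⁅ x ⁆ ∪ ⁅ y ⁆)
  pair⁻ p with d , q ← ∧-true⁻ p = distinct⁻ d , q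

  pair⁺ : ∀ {n} {E : Family n} {x y} → x ≢ y → IsEdge E (⁅ x ⁆ ∪ ⁅ y ⁆) → pair E x y ≡ true
  pair⁺ x≢y q = cong₂ _∧_ (distinct⁺ x≢y) q

  triple⁻ : ∀ {n} {E : Family n} {x y z} → triple E x y z ≡ true →
    x ≢ y × y ≢ z × x ≢ z × IsEdge E (⁅ x ⁆ ∪ (⁅ y ⁆ ∪ ⁅ z ⁆))
  triple⁻ p with d₁ , p₁ ← ∧-true⁻ p with d₂ , p₂ ← ∧-true⁻ p₁ with d₃ , p₃ ← ∧-true⁻ p₂ =
    distinct⁻ d₁ , distinct⁻ d₂ , distinct⁻ d₃ , p₃

  triple⁺ : ∀ {n} {E : Family n} {x y z} → x ≢ y → y ≢ z → x ≢ z → IsEdge E (⁅ x ⁆ ∪ (⁅ y ⁆ ∪ ⁅ z ⁆)) →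
    triple E x y z ≡ true
  triple⁺ x≢y y≢z x≢z q =
    cong₂ _∧_ (distinct⁺ x≢y) (cong₂ _∧_ (distinct⁺ y≢z) (cong₂ _∧_ (distinct⁺ x≢z) q))

  -- A rotation and a transposition generate all reorderings of a triple, so together with
  -- `triple-swap` this supplies the full symmetry.
  triple-rotate : ∀ {n} {E : Family n} {x y z} → triple E x y z ≡ true → triple E y z x ≡ true
  triple-rotate {E = E} {x} {y} {z} p with x≢y , y≢z , x≢z , q ← triple⁻ {E = E} p =
    triple⁺ {E = E} y≢z (x≢z ∘ sym) (x≢y ∘ sym)
      (trans (cong E (trans (sym (∪-assoc ⁅ y ⁆ ⁅ z ⁆ ⁅ x ⁆)) (∪-comm (⁅ y ⁆ ∪ ⁅ z ⁆) ⁅ x ⁆))) q)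

  triple-swap : ∀ {n} {E : Family n} {x y z} → triple E x y z ≡ true → triple E y x z ≡ true
  triple-swap {E = E} {x} {y} {z} p with x≢y , y≢z , x≢z , q ← triple⁻ {E = E} p =
    triple⁺ {E = E} (x≢y ∘ sym) x≢z y≢z (trans (cong E same) q)
    where
    same : ⁅ y ⁆ ∪ (⁅ x ⁆ ∪ ⁅ z ⁆) ≡ ⁅ x ⁆ ∪ (⁅ y ⁆ ∪ ⁅ z ⁆)
    same = trans (sym (∪-assoc ⁅ y ⁆ ⁅ x ⁆ ⁅ z ⁆)) (trans (cong (_∪ ⁅ z ⁆) (∪-comm ⁅ y ⁆ ⁅ x ⁆)) (∪-assoc ⁅ x ⁆ ⁅ y ⁆ ⁅ z ⁆))

  ∈-image⁻ : ∀ {m n} (φ : Fin m → Fin n) (e : Subset m) {j} → j ∈ image φ e → Σ (Fin m) λ i → i ∈ e × φ i ≡ j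
  ∈-image⁻ φ e {j} j∈
    with i , p ← satisfied (any⁻ _ (allFin _) (Equivalence.from T-≡ (trans (sym (lookup∘tabulate _ j)) ([]=⇒lookup j∈))))
    with q , r ← Equivalence.to T-∧ p =
    i , lookup⇒[]= i e (Equivalence.to T-≡ q) , toWitness r

  image-⊆ : ∀ {m n} (φ : Fin m → Fin n) {e : Subset m} {A} → (∀ {i} → i ∈ e → φ i ∈ A) → image φ e ⊆ A
  image-⊆ φ {e} φe⊆A j∈ with i , i∈e , refl ← ∈-image⁻ φ e j∈ = φe⊆A i∈e

  ∪-inˡ : ∀ {n} {x : Fin n} {A B} → x ∈ A → x ∈ A ∪ B
  ∪-inˡ = x∈p∪q⁺ ∘ inj₁

  ∪-inʳ : ∀ {n} {x : Fin n} {A B} → x ∈ B → x ∈ A ∪ B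
  ∪-inʳ = x∈p∪q⁺ ∘ inj₂

  choose : ∀ {n} k (A : Subset n) → k ≤ ∣ A ∣ →
    Σ (Fin k → Fin n) λ φ → Injective _≡_ _≡_ φ × (∀ i → φ i ∈ A)
  choose zero    A             _ = (λ ()) , (λ { {()} }) , λ ()
  choose (suc k) (outside ∷ A) p with φ , inj , φ∈A ← choose (suc k) A p =
    suc ∘ φ , inj ∘ Fin.suc-injective , there ∘ φ∈A
  choose (suc k) (inside ∷ A) (s≤s p) with φ , inj , φ∈A ← choose k A p =
    ψ , ψ-inj , ψ∈
    where
    ψ : Fin (suc k) → Fin _
    ψ zero    = zero
    ψ (suc i) = suc (φ i)
    ψ-inj : Injective _≡_ _≡_ ψ
    ψ-inj {zero}  {zero}  _ = refl
    ψ-inj {suc i} {suc j} p = cong suc (inj (Fin.suc-injective p))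
    ψ∈ : ∀ i → ψ i ∈ inside ∷ A
    ψ∈ zero    = here
    ψ∈ (suc i) = there (φ∈A i)

  module UpperBound {n} (E : Family n) (complex : IsSimplicialComplex E) (free : ¬ ContainsCopy FEdge E) where

    -- All subsets of an edge are edges, so any four vertices inside one edge carry a copy of F.
    sizes≤3 : SizesAtMost 3 E
    sizes≤3 A EA with ∣ A ∣ ≤? 3
    ... | yes p = p
    ... | no ¬p with φ , inj , φ∈A ← choose 4 A (≰⇒> ¬p) =
      ⊥-elim (free (φ , inj , λ e _ → complex A (image φ e) (image-⊆ φ {e} (λ {i} _ → φ∈A i)) EA))

    independent : ∀ {x y a b} → triple E x y a ≡ true → triple E x y b ≡ true → pair E a b ≡ true → ⊥
    independent {x} {y} {a} {b} xya xyb ab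
      with x≢y , y≢a , x≢a , Exya ← triple⁻ {E = E} xya
      with _ , y≢b , x≢b , Exyb ← triple⁻ {E = E} xyb
      with a≢b , Eab ← pair⁻ {E = E} ab =
      free (φ , inj , edge)
      where
      φ : Fin 4 → Fin n
      -- v₁ and v₄ go to a and b, and v₂v₃ goes to the shared pair xy, so the facets of F land in
      -- xya, xyb and ab.
      φ = lookup (a ∷ x ∷ y ∷ b ∷ [])
      inj : Injective _≡_ _≡_ φ
      inj {0F} {0F} _ = refl
      inj {0F} {1F} p = ⊥-elim (x≢a (sym p))
      inj {0F} {2F} p = ⊥-elim (y≢a (sym p))
      inj {0F} {3F} p = ⊥-elim (a≢b p)
      inj {1F} {0F} p = ⊥-elim (x≢a p)
      inj {1F} {1F} _ = refl
      inj {1F} {2F} p = ⊥-elim (x≢y p)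
      inj {1F} {3F} p = ⊥-elim (x≢b p)
      inj {2F} {0F} p = ⊥-elim (y≢a p)
      inj {2F} {1F} p = ⊥-elim (x≢y (sym p))
      inj {2F} {2F} _ = refl
      inj {2F} {3F} p = ⊥-elim (y≢b p)
      inj {3F} {0F} p = ⊥-elim (a≢b (sym p))
      inj {3F} {1F} p = ⊥-elim (x≢b (sym p))
      inj {3F} {2F} p = ⊥-elim (y≢b (sym p))
      inj {3F} {3F} _ = refl
      in123 : ∀ {i} → i ∈ f123 → φ i ∈ ⁅ x ⁆ ∪ (⁅ y ⁆ ∪ ⁅ a ⁆)
      in123 {0F} _ = ∪-inʳ {A = ⁅ x ⁆} (∪-inʳ {A = ⁅ y ⁆} (x∈⁅x⁆ a))
      in123 {1F} _ = ∪-inˡ (x∈⁅x⁆ x)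
      in123 {2F} _ = ∪-inʳ {A = ⁅ x ⁆} (∪-inˡ (x∈⁅x⁆ y))
      in123 {3F} (there (there (there ())))
      in234 : ∀ {i} → i ∈ f234 → φ i ∈ ⁅ x ⁆ ∪ (⁅ y ⁆ ∪ ⁅ b ⁆)
      in234 {0F} ()
      in234 {1F} _ = ∪-inˡ (x∈⁅x⁆ x)
      in234 {2F} _ = ∪-inʳ {A = ⁅ x ⁆} (∪-inˡ (x∈⁅x⁆ y))
      in234 {3F} _ = ∪-inʳ {A = ⁅ x ⁆} (∪-inʳ {A = ⁅ y ⁆} (x∈⁅x⁆ b))
      in14 : ∀ {i} → i ∈ f14 → φ i ∈ ⁅ a ⁆ ∪ ⁅ b ⁆
      in14 {0F} _ = ∪-inˡ (x∈⁅x⁆ a)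
      in14 {1F} (there ())
      in14 {2F} (there (there ()))
      in14 {3F} _ = ∪-inʳ {A = ⁅ a ⁆} (x∈⁅x⁆ b)
      edge : ∀ e → FEdge e → IsEdge E (image φ e)
      edge e (inj₁ e⊆)        = complex _ (image φ e) (image-⊆ φ {e} (λ i∈e → in123 (e⊆ i∈e))) Exya
      edge e (inj₂ (inj₁ e⊆)) = complex _ (image φ e) (image-⊆ φ {e} (λ i∈e → in234 (e⊆ i∈e))) Exyb
      edge e (inj₂ (inj₂ e⊆)) = complex _ (image φ e) (image-⊆ φ {e} (λ i∈e → in14 (e⊆ i∈e))) Eab

    triple⇒pair : ∀ {x y z} → triple E x y z ≡ true → pair E x y ≡ true
    triple⇒pair {x} {y} {z} xyz with x≢y , _ , _ , Exyz ← triple⁻ {E = E} xyz =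
      pair⁺ {E = E} x≢y (complex _ (⁅ x ⁆ ∪ ⁅ y ⁆)
        (subst (⁅ x ⁆ ∪ ⁅ y ⁆ ⊆_) (∪-assoc ⁅ x ⁆ ⁅ y ⁆ ⁅ z ⁆) (λ {i} → p⊆p∪q ⁅ z ⁆ {i})) Exyz)

    -- The factor 54 combines the six orderings of a triple with the 9 of the triple bound.
    54numEdges≤ : 54 * numEdges E ≤ 54 * (1 + n + n * n) + 2 * (n * n * n)
    54numEdges≤ = begin
      54 * numEdges E
        ≡⟨ *-assoc 9 6 (numEdges E) ⟩
      9 * (6 * numEdges E)
        ≤⟨ *-monoʳ-≤ 9 (numEdges-sizes≤3 E sizes≤3) ⟩
      9 * (6 * (1 + n + n * n) + #triples E)
        ≡⟨ distrib (1 + n + n * n) (#triples E) ⟩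
      54 * (1 + n + n * n) + 9 * #triples E
        ≤⟨ +-monoʳ-≤ (54 * (1 + n + n * n)) (Cancellative.9triples≤2n³ (triple E) (pair E)
             (λ {x} {y} {z} → triple-rotate {E = E} {x} {y} {z}) (λ {x} {y} {z} → triple-swap {E = E} {x} {y} {z})
             triple⇒pair (λ {x} {y} → independent {x} {y})) ⟩
      54 * (1 + n + n * n) + 2 * (n * n * n) ∎
      where
      open ≤-Reasoning
      distrib : ∀ a b → 9 * (6 * a + b) ≡ 54 * a + 9 * b
      distrib = solve-∀

  -- The complete tripartite complex

  ∈-image⁺ : ∀ {m n} (φ : Fin m → Fin n) {e : Subset m} {i} → i ∈ e → φ i ∈ image φ e
  ∈-image⁺ φ {e} {i} i∈e = lookup⇒[]= (φ i) _ (trans (lookup∘tabulate _ (φ i))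
    (Equivalence.to T-≡ (any⁺ _ (lose (∈-allFin i)
      (Equivalence.from T-∧ (Equivalence.from T-≡ ([]=⇒lookup i∈e) , fromWitness refl))))))

  -- The vertices are coloured cyclically with three colours; a, b and c tell whether the colours of
  -- the next three vertices are still available.
  rainbow : ∀ {n} → Bool → Bool → Bool → Family n
  rainbow a b c []            = true
  rainbow a b c (outside ∷ A) = rainbow b c a A
  rainbow a b c (inside ∷ A)  = a ∧ rainbow b c false A

  _⇒_ : Bool → Bool → Set
  a ⇒ b = a ≡ true → b ≡ true

  rainbow-mono : ∀ {n} {a b c a′ b′ c′} → a′ ⇒ a → b′ ⇒ b → c′ ⇒ c → (A B : Subset n) → B ⊆ A →
    IsEdge (rainbow a′ b′ c′) A → IsEdge (rainbow a b c) B
  rainbow-mono a b c [] [] _ _ = refl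
  rainbow-mono a b c (outside ∷ A) (outside ∷ B) B⊆A A∈ = rainbow-mono b c a A B (drop-∷-⊆ B⊆A) A∈
  rainbow-mono a b c (inside ∷ A)  (outside ∷ B) B⊆A A∈ =
    rainbow-mono b c (λ ()) A B (drop-∷-⊆ B⊆A) (proj₂ (∧-true⁻ A∈))
  rainbow-mono a b c (inside ∷ A)  (inside ∷ B)  B⊆A A∈ =
    cong₂ _∧_ (a (proj₁ (∧-true⁻ A∈))) (rainbow-mono b c (λ ()) A B (drop-∷-⊆ B⊆A) (proj₂ (∧-true⁻ A∈)))
  rainbow-mono a b c (outside ∷ A) (inside ∷ B)  B⊆A A∈ with () ← B⊆A here

  tripartite : ∀ {n} → Family n
  tripartite = rainbow true true true

  tripartite-complex : ∀ n → IsSimplicialComplex {n} tripartite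
  tripartite-complex n = rainbow-mono (λ p → p) (λ p → p) (λ p → p)

  next : Fin 3 → Fin 3
  next 0F = 1F
  next 1F = 2F
  next 2F = 0F

  next-injective : ∀ i j → next i ≡ next j → i ≡ j
  next-injective 0F 0F _ = refl
  next-injective 1F 1F _ = refl
  next-injective 2F 2F _ = refl
  next-injective 0F 1F ()
  next-injective 0F 2F ()
  next-injective 1F 2F ()

  -- The residue modulo 3. The recursion through `next` mirrors the cyclic shift of the flags that
  -- `rainbow` makes at each vertex.
  colour : ∀ {n} → Fin n → Fin 3
  colour zero    = 0F
  colour (suc x) = next (colour x)

  rainbow-available : ∀ {n a b c} (A : Subset n) {x} → IsEdge (rainbow a b c) A → x ∈ A →
    lookup (a ∷ b ∷ c ∷ []) (colour x) ≡ true
  rainbow-available (inside ∷ A) A∈ here = proj₁ (∧-true⁻ A∈)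
  rainbow-available (outside ∷ A) {suc x} A∈ (there x∈A) with colour x | rainbow-available A A∈ x∈A
  ... | 0F | p = p
  ... | 1F | p = p
  ... | 2F | p = p
  rainbow-available (inside ∷ A) {suc x} A∈ (there x∈A)
    with colour x | rainbow-available A (proj₂ (∧-true⁻ A∈)) x∈A
  ... | 0F | p = p
  ... | 1F | p = p
  ... | 2F | ()

  -- `next (colour x) ≡ 0F` would give x the colour of the vertex just chosen. The tail sees that
  -- colour as colour 2, whose flag is `false`.
  rainbow-used : ∀ {n b c} (A : Subset n) {x} → IsEdge (rainbow b c false) A → x ∈ A → next (colour x) ≢ 0F
  rainbow-used A {x} A∈ x∈A eq with colour x | rainbow-available A A∈ x∈A
  rainbow-used A {x} A∈ x∈A () | 0F | _
  rainbow-used A {x} A∈ x∈A () | 1F | _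
  rainbow-used A {x} A∈ x∈A eq | 2F | ()

  rainbow-injective : ∀ {n a b c} (A : Subset n) {x y} → IsEdge (rainbow a b c) A → x ∈ A → y ∈ A →
    colour x ≡ colour y → x ≡ y
  rainbow-injective (inside ∷ A) A∈ here here _ = refl
  rainbow-injective (inside ∷ A) A∈ here (there y∈A) eq =
    ⊥-elim (rainbow-used A (proj₂ (∧-true⁻ A∈)) y∈A (sym eq))
  rainbow-injective (inside ∷ A) A∈ (there x∈A) here eq =
    ⊥-elim (rainbow-used A (proj₂ (∧-true⁻ A∈)) x∈A eq)
  rainbow-injective (inside ∷ A) A∈ (there x∈A) (there y∈A) eq =
    cong suc (rainbow-injective A (proj₂ (∧-true⁻ A∈)) x∈A y∈A (next-injective _ _ eq))
  rainbow-injective (outside ∷ A) A∈ (there x∈A) (there y∈A) eq =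
    cong suc (rainbow-injective A A∈ x∈A y∈A (next-injective _ _ eq))

  -- The facets v₁v₂v₃ and v₂v₃v₄ cover every pair except v₁v₄, which is the third facet. The
  -- sixteen cases are settled by decision.
  FEdge-pair : ∀ i j → FEdge (⁅ i ⁆ ∪ ⁅ j ⁆)
  FEdge-pair = from-yes (Fin.all? λ i → Fin.all? λ j →
    (⁅ i ⁆ ∪ ⁅ j ⁆) ⊆? f123 ⊎-dec ((⁅ i ⁆ ∪ ⁅ j ⁆) ⊆? f234 ⊎-dec (⁅ i ⁆ ∪ ⁅ j ⁆) ⊆? f14))

  tripartite-free : ∀ n → ¬ ContainsCopy {n = n} FEdge tripartite
  tripartite-free n (φ , inj , edge) with i , j , i<j , eq ← Fin.pigeonhole (n<1+n 3) (colour ∘ φ) =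
    Fin.<⇒≢ i<j (inj (rainbow-injective (image φ (⁅ i ⁆ ∪ ⁅ j ⁆)) (edge _ (FEdge-pair i j))
      (∈-image⁺ φ {e = ⁅ i ⁆ ∪ ⁅ j ⁆} (∪-inˡ (x∈⁅x⁆ i))) (∈-image⁺ φ {e = ⁅ i ⁆ ∪ ⁅ j ⁆} (∪-inʳ {A = ⁅ i ⁆} (x∈⁅x⁆ j))) eq))

  -- The number of vertices of colour i in `Fin n`. Seen from vertex one, the colours are shifted
  -- back by one, hence the cyclic recursion; vertex zero itself adds to colour 0.
  classSize : Fin 3 → ℕ → ℕ
  classSize _  zero    = 0
  classSize 0F (suc n) = suc (classSize 2F n)
  classSize 1F (suc n) = classSize 0F n
  classSize 2F (suc n) = classSize 1F n

  numEdges-rainbow : ∀ n a b c → numEdges {n} (rainbow a b c) ≡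
    (1 + ⟦ a ⟧ * classSize 0F n) * (1 + ⟦ b ⟧ * classSize 1F n) * (1 + ⟦ c ⟧ * classSize 2F n)
  numEdges-rainbow zero a b c
    rewrite *-zeroʳ ⟦ a ⟧ | *-zeroʳ ⟦ b ⟧ | *-zeroʳ ⟦ c ⟧ = refl
  numEdges-rainbow (suc n) true b c = begin
    numEdges {suc n} (rainbow true b c)
      ≡⟨ numEdges-suc {n} (rainbow true b c) ⟩
    numEdges {n} (rainbow b c false) + numEdges {n} (rainbow b c true)
      ≡⟨ cong₂ _+_ (numEdges-rainbow n b c false) (numEdges-rainbow n b c true) ⟩
    (1 + ⟦ b ⟧ * s₀) * (1 + ⟦ c ⟧ * s₁) * 1 + (1 + ⟦ b ⟧ * s₀) * (1 + ⟦ c ⟧ * s₁) * (1 + 1 * s₂)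
      ≡⟨ rearrange (1 + ⟦ b ⟧ * s₀) (1 + ⟦ c ⟧ * s₁) s₂ ⟩
    (1 + 1 * suc s₂) * (1 + ⟦ b ⟧ * s₀) * (1 + ⟦ c ⟧ * s₁) ∎
    where
    open ≡-Reasoning
    s₀ = classSize 0F n
    s₁ = classSize 1F n
    s₂ = classSize 2F n
    rearrange : ∀ x y s → x * y * 1 + x * y * (1 + 1 * s) ≡ (1 + 1 * (1 + s)) * x * y
    rearrange = solve-∀
  numEdges-rainbow (suc n) false b c = begin
    numEdges {suc n} (rainbow false b c)
      ≡⟨ numEdges-suc {n} (rainbow false b c) ⟩
    -- With the first flag `false` no edge contains vertex zero, so the link is empty.
    numEdges {n} (λ _ → false) + numEdges {n} (rainbow b c false)
      ≡⟨ cong₂ _+_ (numEdges-empty {n} (λ _ → false) (λ _ → refl)) (numEdges-rainbow n b c false) ⟩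
    (1 + ⟦ b ⟧ * classSize 0F n) * (1 + ⟦ c ⟧ * classSize 1F n) * 1
      ≡⟨ rearrange (1 + ⟦ b ⟧ * classSize 0F n) (1 + ⟦ c ⟧ * classSize 1F n) ⟩
    1 * (1 + ⟦ b ⟧ * classSize 0F n) * (1 + ⟦ c ⟧ * classSize 1F n) ∎
    where
    open ≡-Reasoning
    rearrange : ∀ x y → x * y * 1 ≡ 1 * x * y
    rearrange = solve-∀

  -- Class i has ⌈(n - i) / 3⌉ elements once n ≥ i. In the induction the offset drops from 2 to 0
  -- exactly when the class gains a vertex.
  n≤colour+3classSize : ∀ n i → n ≤ toℕ i + 3 * classSize i n
  n≤colour+3classSize zero    i  = z≤n
  n≤colour+3classSize (suc n) 0F = ≤-trans (s≤s (n≤colour+3classSize n 2F)) (≤-reflexive (sym (*-suc 3 (classSize 2F n))))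
  n≤colour+3classSize (suc n) 1F = s≤s (n≤colour+3classSize n 0F)
  n≤colour+3classSize (suc n) 2F = s≤s (n≤colour+3classSize n 1F)

  n≤3[1+classSize] : ∀ n i → n ≤ 3 * (1 + 1 * classSize i n)
  n≤3[1+classSize] n i = begin
    n                                      ≤⟨ n≤colour+3classSize n i ⟩
    toℕ i + 3 * classSize i n     ≤⟨ +-monoˡ-≤ _ (<⇒≤ (Fin.toℕ<n i)) ⟩
    3 + 3 * classSize i n                  ≡⟨ expand (classSize i n) ⟩
    3 * (1 + 1 * classSize i n)            ∎
    where
    open ≤-Reasoning
    expand : ∀ s → 3 + 3 * s ≡ 3 * (1 + 1 * s)
    expand = solve-∀

  -- The summand 1 in each factor, meaning no vertex from that class, absorbs the rounding in the
  -- class sizes, so each factor is at least n / 3 and no error term arises.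
  n³≤27numEdges-tripartite : ∀ n → n * n * n ≤ 27 * numEdges {n} tripartite
  n³≤27numEdges-tripartite n = begin
    n * n * n
      ≤⟨ *-mono-≤ (*-mono-≤ (n≤3[1+classSize] n 0F) (n≤3[1+classSize] n 1F)) (n≤3[1+classSize] n 2F) ⟩
    3 * s₀ * (3 * s₁) * (3 * s₂)
      ≡⟨ rearrange s₀ s₁ s₂ ⟩
    27 * (s₀ * s₁ * s₂)
      ≡⟨ cong (27 *_) (numEdges-rainbow n true true true) ⟨
    27 * numEdges {n} tripartite ∎
    where
    open ≤-Reasoning
    s₀ = 1 + 1 * classSize 0F n
    s₁ = 1 + 1 * classSize 1F n
    s₂ = 1 + 1 * classSize 2F n
    rearrange : ∀ a b c → 3 * a * (3 * b) * (3 * c) ≡ 27 * (a * b * c)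
    rearrange = solve-∀

  -- Comparison with binomial coefficients

  2*nC2+n≡n² : ∀ n → 2 * (n C 2) + n ≡ n * n
  2*nC2+n≡n² zero    = refl
  2*nC2+n≡n² (suc n) = begin
    2 * (suc n C 2) + suc n          ≡⟨ cong (λ k → 2 * k + suc n) (nCk+nC[k+1]≡[n+1]C[k+1] n 1) ⟨
    2 * (n C 1 + n C 2) + suc n      ≡⟨ cong (λ k → 2 * (k + n C 2) + suc n) (nC1≡n n) ⟩
    2 * (n + n C 2) + suc n          ≡⟨ rearrange n (n C 2) ⟩
    (2 * (n C 2) + n) + (2 * n + 1)  ≡⟨ cong (_+ (2 * n + 1)) (2*nC2+n≡n² n) ⟩
    n * n + (2 * n + 1)              ≡⟨ square n ⟩
    suc n * suc n                    ∎
    where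
    open ≡-Reasoning
    rearrange : ∀ n k → 2 * (n + k) + (1 + n) ≡ (2 * k + n) + (2 * n + 1)
    rearrange = solve-∀
    square : ∀ n → n * n + (2 * n + 1) ≡ (1 + n) * (1 + n)
    square = solve-∀

  -- The expansion n(n - 1)(n - 2) = n³ - 3n² + 2n without subtraction, by Pascal's rule.
  6*nC3+3n²≡n³+2n : ∀ n → 6 * (n C 3) + 3 * (n * n) ≡ n * n * n + 2 * n
  6*nC3+3n²≡n³+2n zero    = refl
  6*nC3+3n²≡n³+2n (suc n) = begin
    6 * (suc n C 3) + 3 * (suc n * suc n)
      ≡⟨ cong (λ k → 6 * k + 3 * (suc n * suc n)) (nCk+nC[k+1]≡[n+1]C[k+1] n 2) ⟨
    6 * (n C 2 + n C 3) + 3 * (suc n * suc n)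
      ≡⟨ rearrange n (n C 2) (n C 3) ⟩
    3 * (2 * (n C 2) + n) + (6 * (n C 3) + 3 * (n * n)) + (3 * n + 3)
      ≡⟨ cong₂ (λ k l → 3 * k + l + (3 * n + 3)) (2*nC2+n≡n² n) (6*nC3+3n²≡n³+2n n) ⟩
    3 * (n * n) + (n * n * n + 2 * n) + (3 * n + 3)
      ≡⟨ cube n ⟩
    suc n * suc n * suc n + 2 * suc n ∎
    where
    open ≡-Reasoning
    rearrange : ∀ n k l → 6 * (k + l) + 3 * ((1 + n) * (1 + n)) ≡ 3 * (2 * k + n) + (6 * l + 3 * (n * n)) + (3 * n + 3)
    rearrange = solve-∀
    cube : ∀ n → 3 * (n * n) + (n * n * n + 2 * n) + (3 * n + 3) ≡ (1 + n) * (1 + n) * (1 + n) + 2 * (1 + n)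
    cube = solve-∀

  n³≤6*nC3+3n² : ∀ n → n * n * n ≤ 6 * (n C 3) + 3 * (n * n)
  n³≤6*nC3+3n² n = ≤-trans (m≤m+n _ (2 * n)) (≤-reflexive (sym (6*nC3+3n²≡n³+2n n)))

  n≤n² : ∀ n → n ≤ n * n
  n≤n² zero    = z≤n
  n≤n² (suc n) = m≤m*n (suc n) (suc n)

  6*nC3≤n³ : ∀ n → 6 * (n C 3) ≤ n * n * n
  6*nC3≤n³ n = +-cancelʳ-≤ (3 * (n * n)) _ _ (begin
    6 * (n C 3) + 3 * (n * n) ≡⟨ 6*nC3+3n²≡n³+2n n ⟩
    n * n * n + 2 * n         ≤⟨ +-monoʳ-≤ (n * n * n) (*-mono-≤ (n≤1+n 2) (n≤n² n)) ⟩
    n * n * n + 3 * (n * n)   ∎)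
    where open ≤-Reasoning

  2*nC3≤9numEdges-tripartite : ∀ n → 2 * (n C 3) ≤ 9 * numEdges {n} tripartite
  2*nC3≤9numEdges-tripartite n = *-cancelˡ-≤ 3 (begin
    3 * (2 * (n C 3))  ≡⟨ *-assoc 3 2 (n C 3) ⟨
    6 * (n C 3)        ≤⟨ 6*nC3≤n³ n ⟩
    n * n * n          ≤⟨ n³≤27numEdges-tripartite n ⟩
    27 * N             ≡⟨ *-assoc 3 9 N ⟩
    3 * (9 * N)        ∎)
    where
    open ≤-Reasoning
    N = numEdges {n} tripartite

  -- Since 18 · C(n, 3) ≥ 3n³ - 9n², it suffices that 57q + 9 ≤ 3n, which is the source of the
  -- threshold 19q + 3.
  57qn²≤18*nC3 : ∀ q n → 19 * q + 3 ≤ n → 57 * q * (n * n) ≤ 18 * (n C 3)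
  57qn²≤18*nC3 q n n≥ = +-cancelʳ-≤ (9 * (n * n)) _ _ (begin
    57 * q * (n * n) + 9 * (n * n)         ≡⟨ factor q n ⟩
    3 * ((19 * q + 3) * (n * n))           ≤⟨ *-monoʳ-≤ 3 (*-monoˡ-≤ (n * n) n≥) ⟩
    3 * (n * (n * n))                      ≡⟨ cong (3 *_) (*-assoc n n n) ⟨
    3 * (n * n * n)                        ≤⟨ *-monoʳ-≤ 3 (n³≤6*nC3+3n² n) ⟩
    3 * (6 * (n C 3) + 3 * (n * n))        ≡⟨ expand (n C 3) n ⟩
    18 * (n C 3) + 9 * (n * n)             ∎)
    where
    open ≤-Reasoning
    factor : ∀ q n → 57 * q * (n * n) + 9 * (n * n) ≡ 3 * ((19 * q + 3) * (n * n))
    factor = solve-∀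
    expand : ∀ k n → 3 * (6 * k + 3 * (n * n)) ≡ 18 * k + 9 * (n * n)
    expand = solve-∀

  -- Here q will be the denominator of ε, and (2q + 9) / 9q is 2/9 + 1/q. The quadratic terms, which
  -- come from the small edges and from replacing n³ by 6 · C(n, 3), have to fit into the share C(n,
  -- 3) / q.
  numEdges-upper : ∀ {n} (E : Family n) → IsSimplicialComplex E → ¬ ContainsCopy FEdge E →
    ∀ q → 19 * q + 3 ≤ n → numEdges E * (9 * q) ≤ (2 * q + 9) * (n C 3)
  numEdges-upper {n} E complex free q n≥ = *-cancelˡ-≤ 6 (begin
    6 * (N * (9 * q))
      ≡⟨ lhs N q ⟩
    q * (54 * N)
      ≤⟨ *-monoʳ-≤ q (UpperBound.54numEdges≤ E complex free) ⟩
    q * (54 * (1 + n + n * n) + 2 * (n * n * n))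
      ≤⟨ *-monoʳ-≤ q (+-mono-≤ (*-monoʳ-≤ 54 lower-order) (*-monoʳ-≤ 2 (n³≤6*nC3+3n² n))) ⟩
    q * (54 * (3 * (n * n)) + 2 * (6 * K + 3 * (n * n)))
      -- The quadratic terms add up to 168qn²; 3qn² more makes the coefficient 171 = 3 · 57, to
      -- which `57qn²≤18*nC3` applies.
      ≤⟨ m≤m+n _ (3 * q * (n * n)) ⟩
    q * (54 * (3 * (n * n)) + 2 * (6 * K + 3 * (n * n))) + 3 * q * (n * n)
      ≡⟨ middle q n K ⟩
    12 * q * K + 3 * (57 * q * (n * n))
      ≤⟨ +-monoʳ-≤ (12 * q * K) (*-monoʳ-≤ 3 (57qn²≤18*nC3 q n n≥)) ⟩
    12 * q * K + 3 * (18 * K)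
      ≡⟨ rhs q K ⟩
    6 * ((2 * q + 9) * K) ∎)
    where
    open ≤-Reasoning
    N = numEdges E
    K = n C 3
    1≤n : 1 ≤ n
    1≤n = ≤-trans (s≤s z≤n) (≤-trans (m≤n+m 3 (19 * q)) n≥)
    lower-order : 1 + n + n * n ≤ 3 * (n * n)
    lower-order = begin
      1 + n + n * n           ≤⟨ +-monoˡ-≤ (n * n) (+-mono-≤ (*-mono-≤ 1≤n 1≤n) (n≤n² n)) ⟩
      n * n + n * n + n * n   ≡⟨ thrice (n * n) ⟩
      3 * (n * n)             ∎
      where
      thrice : ∀ a → a + a + a ≡ 3 * a
      thrice = solve-∀
    lhs : ∀ N q → 6 * (N * (9 * q)) ≡ q * (54 * N)
    lhs = solve-∀
    middle : ∀ q n K → q * (54 * (3 * (n * n)) + 2 * (6 * K + 3 * (n * n))) + 3 * q * (n * n) ≡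
      12 * q * K + 3 * (57 * q * (n * n))
    middle = solve-∀
    rhs : ∀ q K → 12 * q * K + 3 * (18 * K) ≡ 6 * ((2 * q + 9) * K)
    rhs = solve-∀

open import Data.Nat using (ℕ; _≥_)
open import Data.Nat.Combinatorics using (_C_)
open import Data.Integer using (+_)
open import Data.Rational using (ℚ; _/_; _-_; _+_; _*_; _≤_; Positive)
open import Data.Product using (Σ; _×_)
open import Relation.Nullary using (¬_)

open import Data.Nat using (suc)
open import Data.Product using (_,_)
open import Data.Rational.Unnormalised using (mkℚᵘ)
open import Relation.Binary.PropositionalEquality using (_≡_; sym; trans; cong; subst₂)
import Data.Nat as ℕ
import Data.Nat.Properties as ℕ
import Data.Integer as ℤ
import Data.Integer.Properties as ℤ
import Data.Rational as ℚ
import Data.Rational.Properties as ℚ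
import Data.Rational.Unnormalised as ℚᵘ
import Data.Rational.Unnormalised.Properties as ℚᵘ
open Counting using (tripartite; tripartite-complex; tripartite-free; 2*nC3≤9numEdges-tripartite; numEdges-upper)

-- Passage to rational numbers

toℚᵘ-/1 : ∀ k → ℚ.toℚᵘ (+ k / 1) ℚᵘ.≃ mkℚᵘ (+ k) 0
toℚᵘ-/1 k = ℚ.toℚᵘ-fromℚᵘ (mkℚᵘ (+ k) 0)

-- Clears denominators. `r` is compared with a / (d + 1) as an unnormalised fraction, so that no
-- reduction to lowest terms interferes.
*/1≤/1 : ∀ (r : ℚ) a d K N → ℚ.toℚᵘ r ℚᵘ.≃ mkℚᵘ (+ a) d → a ℕ.* K ℕ.≤ N ℕ.* suc d →
  r * (+ K / 1) ≤ + N / 1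
*/1≤/1 r a d K N r≃ le = ℚ.toℚᵘ-cancel-≤ (begin
  ℚ.toℚᵘ (r * (+ K / 1))              ≃⟨ ℚ.toℚᵘ-homo-* r (+ K / 1) ⟩
  ℚ.toℚᵘ r ℚᵘ.* ℚ.toℚᵘ (+ K / 1)      ≃⟨ ℚᵘ.*-cong r≃ (toℚᵘ-/1 K) ⟩
  mkℚᵘ (+ a) d ℚᵘ.* mkℚᵘ (+ K) 0      ≤⟨ ℚᵘ.*≤* (subst₂ ℤ._≤_ lhs rhs (ℤ.+≤+ le)) ⟩
  mkℚᵘ (+ N) 0                        ≃⟨ toℚᵘ-/1 N ⟨
  ℚ.toℚᵘ (+ N / 1)                    ∎)
  where
  open ℚᵘ.≤-Reasoning
  lhs : + (a ℕ.* K) ≡ (+ a ℤ.* + K) ℤ.* + 1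
  lhs = trans (ℤ.pos-* a K) (sym (ℤ.*-identityʳ _))
  rhs : + (N ℕ.* suc d) ≡ + N ℤ.* (+ (suc d ℕ.* 1))
  rhs = trans (ℤ.pos-* N (suc d)) (cong (λ k → + N ℤ.* + k) (sym (ℕ.*-identityʳ (suc d))))

/1≤*/1 : ∀ (r : ℚ) a d K N → ℚ.toℚᵘ r ℚᵘ.≃ mkℚᵘ (+ a) d → N ℕ.* suc d ℕ.≤ a ℕ.* K →
  + N / 1 ≤ r * (+ K / 1)
/1≤*/1 r a d K N r≃ le = ℚ.toℚᵘ-cancel-≤ (begin
  ℚ.toℚᵘ (+ N / 1)                    ≃⟨ toℚᵘ-/1 N ⟩
  mkℚᵘ (+ N) 0                        ≤⟨ ℚᵘ.*≤* (subst₂ ℤ._≤_ lhs rhs (ℤ.+≤+ le)) ⟩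
  mkℚᵘ (+ a) d ℚᵘ.* mkℚᵘ (+ K) 0      ≃⟨ ℚᵘ.*-cong r≃ (toℚᵘ-/1 K) ⟨
  ℚ.toℚᵘ r ℚᵘ.* ℚ.toℚᵘ (+ K / 1)      ≃⟨ ℚ.toℚᵘ-homo-* r (+ K / 1) ⟨
  ℚ.toℚᵘ (r * (+ K / 1))              ∎)
  where
  open ℚᵘ.≤-Reasoning
  lhs : + (N ℕ.* suc d) ≡ + N ℤ.* (+ (suc d ℕ.* 1))
  lhs = trans (ℤ.pos-* N (suc d)) (cong (λ k → + N ℤ.* + k) (sym (ℕ.*-identityʳ (suc d))))
  rhs : + (a ℕ.* K) ≡ (+ a ℤ.* + K) ℤ.* + 1
  rhs = trans (ℤ.pos-* a K) (sym (ℤ.*-identityʳ _))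

[2/9-ε]*K≤N : ∀ (ε : ℚ) → Positive ε → ∀ K N → 2 ℕ.* K ℕ.≤ 9 ℕ.* N → (+ 2 / 9 - ε) * (+ K / 1) ≤ + N / 1
[2/9-ε]*K≤N ε ε>0 K N le = begin
  (+ 2 / 9 - ε) * (+ K / 1)  ≤⟨ ℚ.*-monoʳ-≤-nonNeg (+ K / 1) {{ℚ.normalize-nonNeg K 1}} 2/9-ε≤2/9 ⟩
  (+ 2 / 9) * (+ K / 1)      ≤⟨ */1≤/1 (+ 2 / 9) 2 8 K N ℚᵘ.≃-refl (ℕ.≤-trans le (ℕ.≤-reflexive (ℕ.*-comm 9 N))) ⟩
  + N / 1                    ∎
  where
  open ℚ.≤-Reasoning
  2/9-ε≤2/9 : + 2 / 9 - ε ≤ + 2 / 9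
  2/9-ε≤2/9 = begin
    + 2 / 9 - ε     ≤⟨ ℚ.+-monoʳ-≤ (+ 2 / 9) (ℚ.neg-antimono-≤ (ℚ.<⇒≤ (ℚ.positive⁻¹ ε {{ε>0}}))) ⟩
    + 2 / 9 + ℚ.0ℚ  ≡⟨ ℚ.+-identityʳ (+ 2 / 9) ⟩
    + 2 / 9         ∎

-- The hypothesis is the bound with 1/q in place of ε, where q is the denominator of ε.
N≤[2/9+ε]*K : ∀ (ε : ℚ) → Positive ε → ∀ K N →
  N ℕ.* (9 ℕ.* ℚ.↧ₙ ε) ℕ.≤ (2 ℕ.* ℚ.↧ₙ ε ℕ.+ 9) ℕ.* K → + N / 1 ≤ (+ 2 / 9 + ε) * (+ K / 1)
N≤[2/9+ε]*K ε@(ℚ.mkℚ (+ suc p) d _) _ K N le =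
  /1≤*/1 (+ 2 / 9 + ε) (2 ℕ.* suc d ℕ.+ suc p ℕ.* 9) _ K N (ℚ.toℚᵘ-homo-+ (+ 2 / 9) ε)
    -- The numerator `suc p` of ε is at least 1, so 9 ≤ `suc p` · 9, which amounts to 1/q ≤ ε.
    (ℕ.≤-trans le (ℕ.*-monoˡ-≤ K (ℕ.+-monoʳ-≤ (2 ℕ.* suc d) (ℕ.m≤n*m 9 (suc p)))))

theorem1p7 : (ε : ℚ) → Positive ε →
    Σ ℕ λ n₀ → (n : ℕ) → n ≥ n₀ →
    (Σ (Family n) λ E → IsSimplicialComplex E × ¬ ContainsCopy FEdge E
    × ((+ 2 / 9 - ε) * (+ (n C 3) / 1) ≤ + numEdges E / 1))
    × ((E : Family n) → IsSimplicialComplex E → ¬ ContainsCopy FEdge E →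
    + numEdges E / 1 ≤ (+ 2 / 9 + ε) * (+ (n C 3) / 1))
theorem1p7 ε ε>0 = 19 ℕ.* ℚ.↧ₙ ε ℕ.+ 3 , λ n n≥n₀ →
  (tripartite , tripartite-complex n , tripartite-free n ,
    [2/9-ε]*K≤N ε ε>0 (n C 3) (numEdges {n} tripartite) (2*nC3≤9numEdges-tripartite n)) ,
  λ E complex free → N≤[2/9+ε]*K ε ε>0 (n C 3) (numEdges E) (numEdges-upper E complex free (ℚ.↧ₙ ε) n≥n₀)
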